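{- Let $T[1..n]$ be a text and let $\bar{r}$ be the number of runs in the Burrows-Wheeler Transform (BWT) of the reverse of $T$. The set of positions in $T$ of the (at most $2\bar{r}$) characters at run boundaries in the BWT of the reverse of $T$ is a suffixient set for $T$.
   Context: Text. $T[1..n]$ ends with a special character $\$ = T[n]$ that occurs nowhere else in $T$ and is smaller than all other characters. Suffix tree. The compacted trie of the suffixes of $T$. The path label of a node is the concatenation of the edge labels on the path from the root to that node. Suffixient set. A set $S \subseteq \{1, \ldots, n\}$ is suffixient for $T$ if, for any edge descending from a node $u$ to a node $v$ in the suffix tree of $T$, there is an element $s \in S$ such that $u$'s path label is a suffix of $T[1..s-1]$ and $T[s]$ is the first character of the label of the edge $(u,v)$. BWT of the reverse of $T$. Sort the positions $s \in \{1, \ldots, n\}$ by the co-lexicographic order of the prefixes $T[1..s-1]$ (i.e., by the lexicographic order of their reverses, the empty prefix being first), giving a sequence $s_1, \ldots, s_n$. The BWT of the reverse of $T$ is the string $T[s_1] T[s_2] \cdots T[s_n]$, and the position in $T$ of its $k$th character is $s_k$. A run is a maximal non-empty block of consecutive equal characters in this string. A character of the BWT is at a run boundary if it is the first or the last character of its run. -}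

module Defs where

open import Data.Fin using (Fin; toℕ) renaming (_≤_ to _≤ᶠ_)
import Data.Fin.Properties as Fin
open import Data.Fin.Subset using (Subset; _∈_)
open import Data.List using (List; []; _∷_; _∷ʳ_; _++_; length; lookup; take; drop; reverse; map; foldr; filter; allFin; cartesianProduct)
open import Data.List.NonEmpty using (List⁺; _∷⁺_; [_]; head; toList)
import Data.List.Membership.Propositional as List
open import Data.List.Relation.Binary.Lex.Strict using (≤-decTotalOrder)
open import Data.List.Relation.Binary.Suffix.Heterogeneous using (Suffix)
open import Data.List.Relation.Unary.All using (All)
import Data.List.Sort as Sort
open import Data.Nat using (ℕ)
open import Data.Product using (∃; _×_; _,_)
open import Data.Sum using (_⊎_)
open import Data.Vec using (tabulate)
open import Level using (Level; _⊔_)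
open import Relation.Binary.Bundles using (StrictTotalOrder; DecTotalOrder)
open import Relation.Binary.Core using (Rel)
import Relation.Binary.Construct.On as On
open import Relation.Binary.Structures using (IsStrictTotalOrder)
open import Relation.Binary.PropositionalEquality using (_≡_)
open import Relation.Nullary using (Dec; yes; no; does; _×-dec_; _⊎-dec_; _→-dec_)

-- Positions 1 … n of a text T are represented by Fin (length T), shifted by
-- one, so that T[1..s-1] is take (toℕ s) T and T[s..n] is drop (toℕ s) T.

module Texts {a ℓ : Level} {A : Set a} {_<_ : Rel A ℓ}
             (<-isStrictTotalOrder : IsStrictTotalOrder _≡_ _<_) where

  open IsStrictTotalOrder <-isStrictTotalOrder using (_≟_)

  record IsText (T : List A) : Set (a ⊔ ℓ) where
    field
      body    : List A
      $       : A
      ends    : T ≡ body ∷ʳ $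
      $∉body  : $ List.∉ body
      $<body  : All ($ <_) body

  Position : List A → Set
  Position T = Fin (length T)

  prefixBefore : (T : List A) → Position T → List A
  prefixBefore T s = take (toℕ s) T

  suffixFrom : (T : List A) → Position T → List A
  suffixFrom T s = drop (toℕ s) T

  data Trie : Set a where
    node : List (A × Trie) → Trie

  mutual
    insert : List A → Trie → Trie
    insert []      t         = t
    insert (c ∷ w) (node cs) = node (insertChild c w cs)

    insertChild : A → List A → List (A × Trie) → List (A × Trie)
    insertChild c w []             = (c , insert w (node [])) ∷ []
    insertChild c w ((d , t) ∷ cs) with c ≟ d
    ... | yes _ = (d , insert w t) ∷ cs
    ... | no  _ = (d , t) ∷ insertChild c w cs

  trie : List (List A) → Trie
  trie = foldr insert (node [])

  data CompactedTrie : Set a where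
    node : List (List⁺ A × CompactedTrie) → CompactedTrie

  -- Every non-root node with exactly one child is dissolved; the root is
  -- always kept.
  mutual
    compact : Trie → CompactedTrie
    compact (node cs) = node (compactChildren cs)

    compactChildren : List (A × Trie) → List (List⁺ A × CompactedTrie)
    compactChildren []             = []
    compactChildren ((c , t) ∷ cs) = compactEdge c t ∷ compactChildren cs

    compactEdge : A → Trie → List⁺ A × CompactedTrie
    compactEdge c (node ((d , t) ∷ [])) with compactEdge d t
    ... | label , v = c ∷⁺ label , v
    compactEdge c t = [ c ] , compact t

  suffixTree : List A → CompactedTrie
  suffixTree T = compact (trie (map (suffixFrom T) (allFin (length T))))

  -- NodeAt t α u: the path with label α from the root of t leads to a node
  -- whose subtree is u.
  data NodeAt (t : CompactedTrie) : List A → CompactedTrie → Set a where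
    root  : NodeAt t [] t
    child : ∀ {α es label v} → NodeAt t α (node es) → (label , v) List.∈ es →
            NodeAt t (α ++ toList label) v

  Suffixient : (T : List A) → Subset (length T) → Set a
  Suffixient T S =
    ∀ {α es label v} → NodeAt (suffixTree T) α (node es) → (label , v) List.∈ es →
    ∃ λ s → s ∈ S × Suffix _≡_ α (prefixBefore T s) × lookup T s ≡ head label

  lexicographic : DecTotalOrder a a (a ⊔ ℓ)
  lexicographic = ≤-decTotalOrder (record { isStrictTotalOrder = <-isStrictTotalOrder })

  colexicographic : (T : List A) → DecTotalOrder _ _ _
  colexicographic T = On.decTotalOrder lexicographic (λ (s : Position T) → reverse (prefixBefore T s))

  sortedPositions : (T : List A) → List (Position T)
  sortedPositions T = Sort.sort (colexicographic T) (allFin (length T))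

  -- The number of BWT characters is written length (sortedPositions T); it
  -- equals length T because sorting permutes the positions.
  BWTIndex : List A → Set
  BWTIndex T = Fin (length (sortedPositions T))

  bwtPosition : (T : List A) → BWTIndex T → Position T
  bwtPosition T k = lookup (sortedPositions T) k

  bwtOfReverse : (T : List A) → BWTIndex T → A
  bwtOfReverse T k = lookup T (bwtPosition T k)

  module _ {m : ℕ} (w : Fin m → A) where

    EqualBlock : Fin m → Fin m → Set a
    EqualBlock i j = i ≤ᶠ j × (∀ k → i ≤ᶠ k → k ≤ᶠ j → w k ≡ w i)

    IsRun : Fin m × Fin m → Set a
    IsRun (i , j) =
      EqualBlock i j ×
      (∀ i′ j′ → EqualBlock i′ j′ → i′ ≤ᶠ i → j ≤ᶠ j′ → i′ ≡ i × j′ ≡ j)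

    AtRunBoundary : Fin m → Set a
    AtRunBoundary k = ∃ λ l → IsRun (k , l) ⊎ IsRun (l , k)

    equalBlock? : ∀ i j → Dec (EqualBlock i j)
    equalBlock? i j =
      (i Fin.≤? j) ×-dec
      Fin.all? (λ k → (i Fin.≤? k) →-dec ((k Fin.≤? j) →-dec (w k ≟ w i)))

    isRun? : ∀ ij → Dec (IsRun ij)
    isRun? (i , j) =
      equalBlock? i j ×-dec
      Fin.all? (λ i′ → Fin.all? (λ j′ →
        equalBlock? i′ j′ →-dec ((i′ Fin.≤? i) →-dec ((j Fin.≤? j′) →-dec
          ((i′ Fin.≟ i) ×-dec (j′ Fin.≟ j))))))

    atRunBoundary? : ∀ k → Dec (AtRunBoundary k)
    atRunBoundary? k = Fin.any? (λ l → isRun? (k , l) ⊎-dec isRun? (l , k))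

    numberOfRuns : ℕ
    numberOfRuns = length (filter isRun? (cartesianProduct (allFin m) (allFin m)))

  r̄ : List A → ℕ
  r̄ T = numberOfRuns (bwtOfReverse T)

  IsBoundaryPosition : (T : List A) → Position T → Set a
  IsBoundaryPosition T s =
    ∃ λ k → AtRunBoundary (bwtOfReverse T) k × bwtPosition T k ≡ s

  isBoundaryPosition? : ∀ T s → Dec (IsBoundaryPosition T s)
  isBoundaryPosition? T s =
    Fin.any? (λ k → atRunBoundary? (bwtOfReverse T) k ×-dec (bwtPosition T k Fin.≟ s))

  boundaryPositions : (T : List A) → Subset (length T)
  boundaryPositions T = tabulate (λ s → does (isBoundaryPosition? T s))

{-# OPTIONS --safe #-}
module Submission where

-- The positions whose prefixes end with α are consecutive in co-lexicographic
-- order.  Let c label an edge leaving the node α, and take a c in the BWT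
-- preceded by α in T.  If neither end of its run were preceded by α, then every
-- occurrence of α would be followed by c, so the node α would have only one
-- child; this is possible only at the root, and there α is empty and precedes
-- every position.

open import Defs
open import Data.Bool using (true)
open import Data.Fin using (Fin; zero; suc; toℕ) renaming (_≤_ to _≤ᶠ_)
import Data.Fin.Properties as Fin
open import Data.Fin.Subset using (Subset; _∈_; _∪_; ⁅_⁆; ∣_∣; ⋃; inside; outside)
open import Data.Fin.Subset.Properties using (∣⊥∣≡0; ∣⁅x⁆∣≡1; x∈⁅x⁆; x∈p∪q⁺; p⊆q⇒∣p∣≤∣q∣)
open import Data.List using (List; []; _∷_; _++_; length; lookup; take; map; filter; allFin; cartesianProduct)
open import Data.List.NonEmpty using (head; tail)
import Data.List.Membership.Propositional as List
open import Data.List.Membership.Propositional.Properties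
  using (∈-map⁺; ∈-map⁻; ∈-++⁺ˡ; ∈-++⁺ʳ; ∈-filter⁺; ∈-allFin; ∈-cartesianProduct⁺)
open import Data.List.Properties using (++-identityʳ; ++-assoc; take++drop≡id; length-++; length-map)
open import Data.List.Relation.Binary.Lex.Strict using (Lex-≤; this; next)
open import Data.List.Relation.Binary.Permutation.Propositional using (↭-sym)
open import Data.List.Relation.Binary.Permutation.Propositional.Properties using (∈-resp-↭)
import Data.List.Relation.Binary.Pointwise as Pointwise
open import Data.List.Relation.Binary.Prefix.Heterogeneous using (Prefix; []; _∷_)
open import Data.List.Relation.Binary.Suffix.Heterogeneous using (Suffix; here; _++ˢ_)
open import Data.List.Relation.Binary.Suffix.Heterogeneous.Properties using (fromPrefix-rev; toPrefix-rev; suffix?)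
open import Data.List.Relation.Unary.All using (All; []; _∷_)
open import Data.List.Relation.Unary.AllPairs using (AllPairs; []; _∷_)
import Data.List.Relation.Unary.All as All
open import Data.List.Relation.Unary.Any using (here; there; index)
open import Data.List.Relation.Unary.Any.Properties using (lookup-index)
open import Data.List.Relation.Unary.Sorted.TotalOrder.Properties using (lookup-mono-≤)
import Data.List.Sort as Sort
open import Data.Nat using (ℕ; _+_; _*_; _≤_; z≤n; s≤s)
import Data.Nat.Properties as ℕ
open import Data.Product using (∃; ∃₂; _×_; _,_; proj₁; proj₂; -,_)
open import Data.Sum as Sum using (_⊎_; inj₁; inj₂)
open import Data.Vec using ([]; _∷_)
open import Data.Vec.Properties using (lookup⇒[]=; []=⇒lookup; lookup∘tabulate)
open import Function using (_∘_; case_of_)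
open import Level using (Level)
open import Relation.Binary.Bundles using (DecTotalOrder)
open import Relation.Binary.Core using (Rel)
open import Relation.Binary.PropositionalEquality using (_≡_; _≢_; refl; sym; trans; cong; cong₂; subst)
open import Relation.Binary.Structures using (IsStrictTotalOrder)
open import Relation.Nullary using (Dec; yes; no; does; contradiction)
open import Relation.Nullary.Decidable using (dec-true)
open import Relation.Unary using (Pred; Decidable)

private
  variable
    a p : Level
    m n : ℕ

-- Decidable subsets of `Fin n` and their sizes.

does-true : {P : Set p} (P? : Dec P) → does P? ≡ true → P
does-true (yes p) _ = p

∣p∪q∣≤∣p∣+∣q∣ : (p q : Subset n) → ∣ p ∪ q ∣ ≤ ∣ p ∣ + ∣ q ∣
∣p∪q∣≤∣p∣+∣q∣ []            []            = z≤n
∣p∪q∣≤∣p∣+∣q∣ (outside ∷ p) (outside ∷ q) = ∣p∪q∣≤∣p∣+∣q∣ p q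
∣p∪q∣≤∣p∣+∣q∣ (outside ∷ p) (inside  ∷ q) =
  ℕ.≤-trans (s≤s (∣p∪q∣≤∣p∣+∣q∣ p q)) (ℕ.≤-reflexive (sym (ℕ.+-suc ∣ p ∣ ∣ q ∣)))
∣p∪q∣≤∣p∣+∣q∣ (inside  ∷ p) (outside ∷ q) = s≤s (∣p∪q∣≤∣p∣+∣q∣ p q)
∣p∪q∣≤∣p∣+∣q∣ (inside  ∷ p) (inside  ∷ q) =
  s≤s (ℕ.≤-trans (∣p∪q∣≤∣p∣+∣q∣ p q) (ℕ.+-monoʳ-≤ ∣ p ∣ (ℕ.n≤1+n ∣ q ∣)))

∣⋃⁅xs⁆∣≤length : (xs : List (Fin n)) → ∣ ⋃ (map ⁅_⁆ xs) ∣ ≤ length xs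
∣⋃⁅xs⁆∣≤length {n} []       = ℕ.≤-reflexive (∣⊥∣≡0 n)
∣⋃⁅xs⁆∣≤length     (x ∷ xs) =
  ℕ.≤-trans (∣p∪q∣≤∣p∣+∣q∣ ⁅ x ⁆ (⋃ (map ⁅_⁆ xs)))
            (ℕ.+-mono-≤ (ℕ.≤-reflexive (∣⁅x⁆∣≡1 x)) (∣⋃⁅xs⁆∣≤length xs))

∈-⋃⁅⁆ : {x : Fin n} {xs : List (Fin n)} → x List.∈ xs → x ∈ ⋃ (map ⁅_⁆ xs)
∈-⋃⁅⁆ (here refl)  = x∈p∪q⁺ (inj₁ (x∈⁅x⁆ _))
∈-⋃⁅⁆ (there x∈xs) = x∈p∪q⁺ (inj₂ (∈-⋃⁅⁆ x∈xs))

-- Replacing `xs` by the union of its singletons reduces the count to monotonicity of cardinality,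
-- so repeated entries of `xs` do no harm.
covered⇒∣p∣≤length : (p : Subset n) (xs : List (Fin n)) →
                     (∀ {x} → x ∈ p → x List.∈ xs) → ∣ p ∣ ≤ length xs
covered⇒∣p∣≤length p xs p⊆xs =
  ℕ.≤-trans (p⊆q⇒∣p∣≤∣q∣ (∈-⋃⁅⁆ ∘ p⊆xs)) (∣⋃⁅xs⁆∣≤length xs)

-- Extremal elements of decidable predicates on `Fin m`.

least : {P : Pred (Fin m) p} → Decidable P → ∀ k → P k →
        ∃ λ i → P i × (∀ j → P j → i ≤ᶠ j)
least P? zero    pk = zero , pk , λ _ _ → z≤n
least P? (suc k) pk with P? zero
... | yes p₀ = zero , p₀ , λ _ _ → z≤n
... | no ¬p₀ with least (P? ∘ suc) k pk
...   | i , pi , i≤ = suc i , pi , λ where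
        zero    p₀ → contradiction p₀ ¬p₀
        (suc j) pj → s≤s (i≤ j pj)

greatest : {P : Pred (Fin m) p} → Decidable P → ∀ k → P k →
           ∃ λ i → P i × (∀ j → P j → j ≤ᶠ i)
greatest P? (suc k) pk with greatest (P? ∘ suc) k pk
... | i , pi , ≤i = suc i , pi , λ where
        zero    _  → z≤n
        (suc j) pj → s≤s (≤i j pj)
-- The witness `zero` says nothing about larger indices, so a search must settle whether one exists.
-- The recursion then descends on `m`, since the new witness is arbitrary.
greatest P? zero pk with Fin.any? (P? ∘ suc)
... | no ∄p = zero , pk , λ where
        zero    _  → z≤n
        (suc j) pj → contradiction (j , pj) ∄p
... | yes (k , pk′) with greatest (P? ∘ suc) k pk′
...   | i , pi , ≤i = suc i , pi , λ where
        zero    _  → z≤n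
        (suc j) pj → s≤s (≤i j pj)

-- Splitting lists at prefixes and positions.

module _ {A : Set a} where

  []-suffix : (xs : List A) → Suffix _≡_ [] xs
  []-suffix xs = subst (Suffix _≡_ []) (++-identityʳ xs) (xs ++ˢ here Pointwise.[])

  prefix⇒++ : {xs ys : List A} → Prefix _≡_ xs ys → ∃ λ zs → ys ≡ xs ++ zs
  prefix⇒++ []           = -, refl
  prefix⇒++ (refl ∷ pre) with prefix⇒++ pre
  ... | zs , refl = zs , refl

  splitPosition : (T xs : List A) {c : A} {ys : List A} → T ≡ xs ++ c ∷ ys →
                  ∃ λ (s : Fin (length T)) → take (toℕ s) T ≡ xs × lookup T s ≡ c
  splitPosition _ []       refl = zero , refl , refl
  splitPosition _ (x ∷ xs) refl with splitPosition _ xs refl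
  ... | s , take≡ , lookup≡ = suc s , cong (x ∷_) take≡ , lookup≡

module _ {a ℓ : Level} {A : Set a} {_<_ : Rel A ℓ}
         (<-isStrictTotalOrder : IsStrictTotalOrder _≡_ _<_) where

  open Texts <-isStrictTotalOrder
  open IsStrictTotalOrder <-isStrictTotalOrder using (_≟_; asym; irrefl)

  -- Paths in the uncompacted trie.

  data Reaches : Trie → List A → Trie → Set a where
    []  : ∀ {t} → Reaches t [] t
    _∷_ : ∀ {cs c t w u} → (c , t) List.∈ cs → Reaches t w u → Reaches (node cs) (c ∷ w) u

  Reaches-++ : ∀ {t u v w x} → Reaches t w u → Reaches u x v → Reaches t (w ++ x) v
  Reaches-++ []      s = s
  Reaches-++ (e ∷ r) s = e ∷ Reaches-++ r s

  mutual
    -- A path either follows old edges or runs along the inserted word. The old endpoint is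
    -- existential because insertion may have enlarged the subtree found there.
    Reaches-insert : ∀ v t {w u} → Reaches (insert v t) w u →
                     ∃ (Reaches t w) ⊎ Prefix _≡_ w v
    Reaches-insert []      t         r       = inj₁ (-, r)
    Reaches-insert (c ∷ v) (node cs) []      = inj₂ []
    Reaches-insert (c ∷ v) (node cs) (e ∷ r) = Reaches-insertChild c v cs e r

    Reaches-insertChild : ∀ c v cs {d t w u} → (d , t) List.∈ insertChild c v cs → Reaches t w u →
                          ∃ (Reaches (node cs) (d ∷ w)) ⊎ Prefix _≡_ (d ∷ w) (c ∷ v)
    Reaches-insertChild c v [] (here refl) r with Reaches-insert v (node []) r
    ... | inj₁ (_ , [])     = inj₂ (refl ∷ [])
    ... | inj₁ (_ , () ∷ _)
    ... | inj₂ pre          = inj₂ (refl ∷ pre)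
    Reaches-insertChild c v ((d , t) ∷ cs) e r with c ≟ d
    Reaches-insertChild c v ((d , t) ∷ cs) (here refl) r | yes refl with Reaches-insert v t r
    ... | inj₁ (_ , r′) = inj₁ (-, here refl ∷ r′)
    ... | inj₂ pre      = inj₂ (refl ∷ pre)
    Reaches-insertChild c v ((d , t) ∷ cs) (there e)   r | yes refl = inj₁ (-, there e ∷ r)
    Reaches-insertChild c v ((d , t) ∷ cs) (here refl) r | no _     = inj₁ (-, here refl ∷ r)
    Reaches-insertChild c v ((d , t) ∷ cs) (there e)   r | no _ with Reaches-insertChild c v cs e r
    ... | inj₁ (_ , e′ ∷ r′) = inj₁ (-, there e′ ∷ r′)
    ... | inj₂ pre           = inj₂ pre

  -- The word is taken nonempty because the trivial path exists even in the empty trie, where no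
  -- inserted word accounts for it.
  Reaches-trie : ∀ ws {c w u} → Reaches (trie ws) (c ∷ w) u →
                 ∃ λ v → v List.∈ ws × Prefix _≡_ (c ∷ w) v
  Reaches-trie []       (() ∷ _)
  Reaches-trie (v ∷ ws) r with Reaches-insert v (trie ws) r
  ... | inj₂ pre      = v , here refl , pre
  ... | inj₁ (_ , r′) with Reaches-trie ws r′
  ...   | v′ , v′∈ , pre = v′ , there v′∈ , pre

  -- Distinctness of the keys at each trie node.

  DistinctKeys : Rel (A × Trie) a
  DistinctKeys x y = proj₁ x ≢ proj₁ y

  data Deterministic : Trie → Set a where
    node : ∀ {cs} → AllPairs DistinctKeys cs → All (Deterministic ∘ proj₂) cs →
           Deterministic (node cs)

  -- Insertion keeps the existing keys and adds at most the key `c`.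
  insertChild-fresh : ∀ c w cs x → proj₁ x ≢ c → All (DistinctKeys x) cs →
                      All (DistinctKeys x) (insertChild c w cs)
  insertChild-fresh c w []             x x≢c []           = x≢c ∷ []
  insertChild-fresh c w ((d , t) ∷ cs) x x≢c (x≢d ∷ x≢cs) with c ≟ d
  ... | yes _ = x≢d ∷ x≢cs
  ... | no  _ = x≢d ∷ insertChild-fresh c w cs x x≢c x≢cs

  insertChild-distinct : ∀ c w cs → AllPairs DistinctKeys cs →
                         AllPairs DistinctKeys (insertChild c w cs)
  insertChild-distinct c w []             []            = [] ∷ []
  insertChild-distinct c w ((d , t) ∷ cs) (d≢cs ∷ dist) with c ≟ d
  ... | yes _  = d≢cs ∷ dist
  ... | no c≢d = insertChild-fresh c w cs (d , t) (c≢d ∘ sym) d≢cs ∷ insertChild-distinct c w cs dist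

  mutual
    insert-deterministic : ∀ w t → Deterministic t → Deterministic (insert w t)
    insert-deterministic []      t         det             = det
    insert-deterministic (c ∷ w) (node cs) (node dist det) =
      node (insertChild-distinct c w cs dist) (insertChild-deterministic c w cs det)

    insertChild-deterministic : ∀ c w cs → All (Deterministic ∘ proj₂) cs →
                                All (Deterministic ∘ proj₂) (insertChild c w cs)
    insertChild-deterministic c w []             []         =
      insert-deterministic w (node []) (node [] []) ∷ []
    insertChild-deterministic c w ((d , t) ∷ cs) (dt ∷ dcs) with c ≟ d
    ... | yes _ = insert-deterministic w t dt ∷ dcs
    ... | no  _ = dt ∷ insertChild-deterministic c w cs dcs

  trie-deterministic : ∀ ws → Deterministic (trie ws)
  trie-deterministic []       = node [] []
  trie-deterministic (w ∷ ws) = insert-deterministic w (trie ws) (trie-deterministic ws)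

  Reaches-deterministic : ∀ {t w u} → Reaches t w u → Deterministic t → Deterministic u
  Reaches-deterministic []      det          = det
  Reaches-deterministic (e ∷ r) (node _ det) = Reaches-deterministic r (All.lookup det e)

  -- Branching and compaction.

  NonUnary : Trie → Set a
  NonUnary (node cs) = ∀ x → cs ≢ x ∷ []

  -- The given edge excludes a leaf, so there are at least two children. The second serves if the
  -- given edge is the first, and the first serves otherwise; determinism makes the keys differ.
  distinctSibling : ∀ {cs c t} → Deterministic (node cs) → NonUnary (node cs) →
                    (c , t) List.∈ cs → ∃₂ λ d u → d ≢ c × (d , u) List.∈ cs
  distinctSibling {_ ∷ []}    _ nonUnary _ = contradiction refl (nonUnary _)
  distinctSibling {_ ∷ _ ∷ _} (node ((x≢y ∷ _) ∷ _) _) _ (here refl) =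
    -, -, x≢y ∘ sym , there (here refl)
  distinctSibling {_ ∷ _ ∷ _} (node (x≢ ∷ _) _) _ (there e) =
    -, -, All.lookup x≢ e , here refl

  -- The dissolved chain of one-child nodes spells the tail of the label. It stops at the first leaf
  -- or branching node, and both of these are `NonUnary`.
  compactEdge-reaches : ∀ c t → let label , v = compactEdge c t in
    head label ≡ c × ∃ λ u → Reaches t (tail label) u × v ≡ compact u × NonUnary u
  compactEdge-reaches c (node [])              = refl , -, [] , refl , λ _ ()
  compactEdge-reaches c (node (_ ∷ _ ∷ _))     = refl , -, [] , refl , λ _ ()
  compactEdge-reaches c (node ((d , t) ∷ []))
    with compactEdge d t | compactEdge-reaches d t
  ... | label , v | refl , u , r , v≡ , nonUnary = refl , u , here refl ∷ r , v≡ , nonUnary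

  ∈-compactChildren : ∀ cs {e} → e List.∈ compactChildren cs →
                      ∃₂ λ c t → (c , t) List.∈ cs × e ≡ compactEdge c t
  ∈-compactChildren ((c , t) ∷ cs) (here e≡)  = c , t , here refl , e≡
  ∈-compactChildren ((c , t) ∷ cs) (there e∈) with ∈-compactChildren cs e∈
  ... | c′ , t′ , ∈cs , e≡ = c′ , t′ , there ∈cs , e≡

  -- Every node below the root is the end of a dissolved chain, hence `NonUnary`. The root is kept
  -- even with a single child, which accounts for the alternative `α ≡ []`.
  NodeAt-reaches : ∀ {t α v} → NodeAt (compact t) α v →
                   ∃ λ u → Reaches t α u × v ≡ compact u × (α ≡ [] ⊎ NonUnary u)
  NodeAt-reaches root = -, [] , refl , inj₁ refl
  NodeAt-reaches (child nodeAt e∈) with NodeAt-reaches nodeAt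
  ... | node cs , r , refl , _ with ∈-compactChildren cs e∈
  ...   | c , t , ∈cs , refl with compactEdge c t | compactEdge-reaches c t
  ...     | label , v | refl , u , r′ , v≡ , nonUnary =
              u , Reaches-++ r (∈cs ∷ r′) , v≡ , inj₂ nonUnary

  -- Edges of the suffix tree as occurrences in the text.

  Occurs : (T α : List A) → A → Position T → Set a
  Occurs T α c s = Suffix _≡_ α (prefixBefore T s) × lookup T s ≡ c

  -- A nonempty word read in the trie is a prefix of some suffix of `T`. The position sought is that
  -- of `c`, which lies `length α` places after the start of this suffix.
  reaches⇒occurs : ∀ T α {c u} →
    Reaches (trie (map (suffixFrom T) (allFin (length T)))) (α ++ c ∷ []) u → ∃ (Occurs T α c)
  reaches⇒occurs T α {c} r = case nonEmpty α r of λ where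
      (v , v∈ , pre) → case ∈-map⁻ (suffixFrom T) v∈ , prefix⇒++ pre of λ where
        ((s , _ , v≡) , zs , v≡′) → found s (trans (sym v≡) v≡′)
    where
    ws = map (suffixFrom T) (allFin (length T))

    -- Case distinction on `α` exposes the first letter of `α ++ c ∷ []`, which `Reaches-trie` asks
    -- for.
    nonEmpty : ∀ α {u} → Reaches (trie ws) (α ++ c ∷ []) u →
               ∃ λ v → v List.∈ ws × Prefix _≡_ (α ++ c ∷ []) v
    nonEmpty []      = Reaches-trie ws
    nonEmpty (_ ∷ _) = Reaches-trie ws

    found : ∀ s {zs} → suffixFrom T s ≡ (α ++ c ∷ []) ++ zs → ∃ (Occurs T α c)
    -- Cutting `T` just before this `c` leaves `prefixBefore T s ++ α`, a text ending with `α`.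
    found s {zs} eq with splitPosition T (prefixBefore T s ++ α) {c} {zs}
                           (trans (sym (take++drop≡id (toℕ s) T))
                           (trans (cong (prefixBefore T s ++_) (trans eq (++-assoc α (c ∷ []) zs)))
                                  (sym (++-assoc (prefixBefore T s) α (c ∷ zs)))))
    ... | q , take≡ , lookup≡ =
      q , subst (Suffix _≡_ α) (sym take≡) (prefixBefore T s ++ˢ here (Pointwise.refl refl)) , lookup≡

  -- This is all that the later argument uses of the suffix tree. Away from the root, a sibling edge
  -- supplies a second letter that follows `α` somewhere in `T`.
  suffixTree-edge : ∀ T {α es label v} → NodeAt (suffixTree T) α (node es) → (label , v) List.∈ es →
    ∃ (Occurs T α (head label)) × (α ≡ [] ⊎ ∃ λ d → d ≢ head label × ∃ (Occurs T α d))
  suffixTree-edge T {α} nodeAt e∈ with NodeAt-reaches nodeAt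
  ... | node cs , r , refl , shape with ∈-compactChildren cs e∈
  ...   | c , t , ∈cs , refl with compactEdge c t | compactEdge-reaches c t
  ...     | label , v | refl , _ = occurs ∈cs , (case shape of λ where
              (inj₁ α≡[])    → inj₁ α≡[]
              (inj₂ nonUnary) →
                let d , _ , d≢c , ∈cs′ = distinctSibling det nonUnary ∈cs
                in inj₂ (d , d≢c , occurs ∈cs′))
    where
    det = Reaches-deterministic r (trie-deterministic (map (suffixFrom T) (allFin (length T))))

    occurs : ∀ {d u} → (d , u) List.∈ cs → ∃ (Occurs T α d)
    occurs ∈cs = reaches⇒occurs T α (Reaches-++ r (∈cs ∷ []))

  -- Intervals in the co-lexicographic order.

  prefix-convex : ∀ {β x y z} → Lex-≤ _≡_ _<_ x y → Lex-≤ _≡_ _<_ y z →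
                  Prefix _≡_ β x → Prefix _≡_ β z → Prefix _≡_ β y
  prefix-convex x≤y             y≤z             []            []            = []
  -- If `y` first departs from `β` at some letter, that letter would have to be both above and below
  -- the letter of `β` there.
  prefix-convex (this b<y)      (this y<b)      (refl ∷ _)    (refl ∷ _)    = contradiction y<b (asym b<y)
  prefix-convex (this b<y)      (next refl _)   (refl ∷ _)    (refl ∷ _)    = contradiction b<y (irrefl refl)
  prefix-convex (next refl _)   (this y<b)      (refl ∷ _)    (refl ∷ _)    = contradiction y<b (irrefl refl)
  prefix-convex (next refl x≤y) (next refl y≤z) (refl ∷ pre)  (refl ∷ pre′) =
    refl ∷ prefix-convex x≤y y≤z pre pre′

  module _ (T : List A) where

    bwtPosition-mono : ∀ {i j} → i ≤ᶠ j →
      DecTotalOrder._≤_ (colexicographic T) (bwtPosition T i) (bwtPosition T j)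
    bwtPosition-mono = lookup-mono-≤ (DecTotalOrder.totalOrder (colexicographic T))
      (Sort.sort-↗ (colexicographic T) (allFin (length T)))

    bwtIndex : ∀ s → ∃ λ k → bwtPosition T k ≡ s
    bwtIndex s = index s∈ , sym (lookup-index s∈)
      where
      s∈ : s List.∈ sortedPositions T
      s∈ = ∈-resp-↭ (↭-sym (Sort.sort-↭ (colexicographic T) (allFin (length T)))) (∈-allFin s)

    PrecededBy : List A → BWTIndex T → Set a
    PrecededBy α k = Suffix _≡_ α (prefixBefore T (bwtPosition T k))

    -- The sort compares reversed prefixes, and reversal turns ending with `α` into starting with
    -- the reverse of `α`, so convexity of prefixes applies.
    precededBy-convex : ∀ {α i j k} → i ≤ᶠ j → j ≤ᶠ k →
                        PrecededBy α i → PrecededBy α k → PrecededBy α j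
    precededBy-convex i≤j j≤k αi αk = fromPrefix-rev
      (prefix-convex (bwtPosition-mono i≤j) (bwtPosition-mono j≤k) (toPrefix-rev αi) (toPrefix-rev αk))

    boundary⇒∈ : ∀ {s} → IsBoundaryPosition T s → s ∈ boundaryPositions T
    boundary⇒∈ {s} b = lookup⇒[]= s (boundaryPositions T)
      (trans (lookup∘tabulate (does ∘ isBoundaryPosition? T) s) (dec-true (isBoundaryPosition? T s) b))

    ∈⇒boundary : ∀ {s} → s ∈ boundaryPositions T → IsBoundaryPosition T s
    ∈⇒boundary {s} s∈ = does-true (isBoundaryPosition? T s)
      (trans (sym (lookup∘tabulate (does ∘ isBoundaryPosition? T) s)) ([]=⇒lookup s∈))

  -- Runs and convex sets of indices.

  module _ {m : ℕ} (w : Fin m → A) where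

    -- The equal blocks ending at `k` and those starting at `k` are extended independently as far as
    -- possible; the two longest ones join at `k` into the run.
    runAround : ∀ k → ∃₂ λ i j → IsRun w (i , j) × i ≤ᶠ k × k ≤ᶠ j
    runAround k
      with least (λ i → equalBlock? w i k) k (ℕ.≤-refl , λ l k≤l l≤k → cong w (Fin.≤-antisym l≤k k≤l))
         | greatest (equalBlock? w k) k (ℕ.≤-refl , λ l k≤l l≤k → cong w (Fin.≤-antisym l≤k k≤l))
    ... | i , (i≤k , eqᵢ) , i-least | j , (k≤j , eqⱼ) , j-greatest =
      i , j , ((ℕ.≤-trans i≤k k≤j , joined) , maximal) , i≤k , k≤j
      where
      joined : ∀ l → i ≤ᶠ l → l ≤ᶠ j → w l ≡ w i
      joined l i≤l l≤j with Fin.≤-total l k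
      ... | inj₁ l≤k = eqᵢ l i≤l l≤k
      ... | inj₂ k≤l = trans (eqⱼ l k≤l l≤j) (eqᵢ k i≤k ℕ.≤-refl)

      -- A block containing the joined one also contains `k`. Cut there, it gives a block ending at
      -- `k` and one starting at `k`, to which the extremality of `i` and `j` applies.
      maximal : ∀ i′ j′ → EqualBlock w i′ j′ → i′ ≤ᶠ i → j ≤ᶠ j′ → i′ ≡ i × j′ ≡ j
      maximal i′ j′ (_ , eq) i′≤i j≤j′ =
          Fin.≤-antisym i′≤i (i-least i′ (i′≤k , λ l i′≤l l≤k → eq l i′≤l (ℕ.≤-trans l≤k k≤j′)))
        , Fin.≤-antisym (j-greatest j′ (k≤j′ , λ l k≤l l≤j′ →
            trans (eq l (ℕ.≤-trans i′≤k k≤l) l≤j′) (sym (eq k i′≤k k≤j′)))) j≤j′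
        where
        i′≤k = ℕ.≤-trans i′≤i i≤k
        k≤j′ = ℕ.≤-trans k≤j j≤j′

    -- If both ends of the run around `k` fail `P`, convexity traps all indices satisfying `P`
    -- between them, where `w` is constant. A universal `P` contradicts the failure, a differing
    -- letter the constancy.
    boundaryInConvex : {P : Pred (Fin m) p} → Decidable P →
      (∀ {i j k} → i ≤ᶠ j → j ≤ᶠ k → P i → P k → P j) →
      ∀ k → P k → (∀ i → P i) ⊎ (∃ λ l → P l × w l ≢ w k) →
      ∃ λ b → AtRunBoundary w b × P b × w b ≡ w k
    boundaryInConvex {P = P} P? convex k pk shape with runAround k
    ... | i , j , run@((i≤j , eq) , _) , i≤k , k≤j with P? i | P? j
    ...   | yes pi | _      = i , (j , inj₁ run) , pi , sym (eq k i≤k k≤j)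
    ...   | no _   | yes pj =
      j , (i , inj₂ run) , pj , trans (eq j i≤j ℕ.≤-refl) (sym (eq k i≤k k≤j))
    ...   | no ¬pi | no ¬pj with shape
    ...     | inj₁ all              = contradiction (all i) ¬pi
    ...     | inj₂ (l , pl , wl≢wk) =
      contradiction (trans (eq l i≤l l≤j) (sym (eq k i≤k k≤j))) wl≢wk
      where
      i≤l : i ≤ᶠ l
      i≤l with Fin.≤-total i l
      ... | inj₁ i≤l = i≤l
      -- Otherwise `i` would lie between `l` and `k`, and convexity would give `P i`.
      ... | inj₂ l≤i = contradiction (convex l≤i i≤k pl pk) ¬pi

      l≤j : l ≤ᶠ j
      l≤j with Fin.≤-total l j
      ... | inj₁ l≤j = l≤j
      ... | inj₂ j≤l = contradiction (convex k≤j j≤l pk pl) ¬pj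

  -- Suffixience and size of the set of boundary positions.

  occurs⇒boundaryOccurs : ∀ T α {c} → ∃ (Occurs T α c) →
    α ≡ [] ⊎ (∃ λ d → d ≢ c × ∃ (Occurs T α d)) →
    ∃ λ b → IsBoundaryPosition T b × Occurs T α c b
  occurs⇒boundaryOccurs T α {c} (s , αs , s≡c) shape =
    let k , k≡s = bwtIndex T s
        k≡c = trans (cong (lookup T) k≡s) s≡c
        b , boundary , αb , b≡k = boundaryInConvex (bwtOfReverse T) precededBy? (precededBy-convex T)
          -- At the root the empty word precedes every position. Elsewhere the occurrence followed
          -- by `d` yields an index, also preceded by `α`, whose BWT letter differs from `c`.
          k (precededBy k≡s αs) (Sum.map (λ { refl i → []-suffix _ }) (λ { (d , d≢c , s′ , αs′ , s′≡d) →
            let l , l≡s′ = bwtIndex T s′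
            in l , precededBy l≡s′ αs′ ,
               λ l≡k → d≢c (trans (sym s′≡d) (trans (cong (lookup T) (sym l≡s′)) (trans l≡k k≡c))) }) shape)
    in bwtPosition T b , (b , boundary , refl) , αb , trans b≡k k≡c
    where
    precededBy? : Decidable (PrecededBy T α)
    precededBy? k = suffix? _≟_ α (prefixBefore T (bwtPosition T k))

    precededBy : ∀ {k s} → bwtPosition T k ≡ s → Suffix _≡_ α (prefixBefore T s) → PrecededBy T α k
    precededBy k≡s = subst (Suffix _≡_ α ∘ prefixBefore T) (sym k≡s)

  boundaryPositions-suffixient : ∀ T → Suffixient T (boundaryPositions T)
  boundaryPositions-suffixient T {α} nodeAt e∈ =
    let occurs , shape = suffixTree-edge T nodeAt e∈
        b , boundary , occursAtB = occurs⇒boundaryOccurs T α occurs shape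
    in b , boundary⇒∈ T boundary , occursAtB

  -- The list of runs is mapped once to first and once to last positions. A one-letter run lists its
  -- position twice, so the length bounds the cardinality only from above.
  ∣boundaryPositions∣≤2r̄ : ∀ T → ∣ boundaryPositions T ∣ ≤ 2 * r̄ T
  ∣boundaryPositions∣≤2r̄ T =
    subst (∣ boundaryPositions T ∣ ≤_) lengthRunEnds
      (covered⇒∣p∣≤length (boundaryPositions T) (map first runs ++ map last runs) (covered ∘ ∈⇒boundary T))
    where
    w = bwtOfReverse T
    runs = filter (isRun? w) (cartesianProduct (allFin _) (allFin _))
    first last : BWTIndex T × BWTIndex T → Position T
    first = bwtPosition T ∘ proj₁
    last  = bwtPosition T ∘ proj₂

    ∈-runs : ∀ {i j} → IsRun w (i , j) → (i , j) List.∈ runs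
    ∈-runs = ∈-filter⁺ (isRun? w) (∈-cartesianProduct⁺ (∈-allFin _) (∈-allFin _))

    covered : ∀ {s} → IsBoundaryPosition T s → s List.∈ map first runs ++ map last runs
    covered (_ , (_ , inj₁ run) , refl) = ∈-++⁺ˡ (∈-map⁺ first (∈-runs run))
    covered (_ , (_ , inj₂ run) , refl) = ∈-++⁺ʳ (map first runs) (∈-map⁺ last (∈-runs run))

    lengthRunEnds : length (map first runs ++ map last runs) ≡ 2 * r̄ T
    lengthRunEnds = trans (length-++ (map first runs))
      (cong₂ _+_ (length-map first runs)
                 -- The product `2 * r̄ T` unfolds to `r̄ T + (r̄ T + 0)`.
                 (trans (length-map last runs) (sym (ℕ.+-identityʳ (length runs)))))

lemma1 : ∀ {a ℓ : Level} {A : Set a} {_<_ : Rel A ℓ}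
    (<-isStrictTotalOrder : IsStrictTotalOrder _≡_ _<_) →
    let open Texts <-isStrictTotalOrder in
    (T : List A) → IsText T →
    Suffixient T (boundaryPositions T) × (∣ boundaryPositions T ∣ ≤ 2 * r̄ T)
lemma1 <-isStrictTotalOrder T _ =
  boundaryPositions-suffixient <-isStrictTotalOrder T , ∣boundaryPositions∣≤2r̄ <-isStrictTotalOrder T
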